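{- Let $0\leq r_1\leq \frac{r_2}{2}$ and let $T$ be a metric tree with $|T|\leq 2(r_1+r_2)$. Then $(r_1,r_2)$ is a cover of $T$.
   Context: A metric tree $T$ is obtained from a finite tree with at least one vertex by replacing each edge by a closed real interval of positive length whose endpoints are identified with the end vertices of the edge; $|T|$ denotes the sum of the lengths of these intervals, and $d_T$ is the path-length metric on $T$. For $v\in T$ and $r\ge 0$, $B_T(v,r)=\{u\in T: d_T(v,u)\leq r\}$. A finite sequence $(r_1,\dots,r_m)$ of non-negative reals is a cover of $T$ if there exist $v_1,\dots,v_m\in T$ with $T=\bigcup_{i=1}^m B_T(v_i,r_i)$. -}

module Defs where

open import Level using (0ℓ)
open import Data.Nat using (ℕ; zero; suc)
open import Data.Fin using (Fin; zero; suc)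
open import Data.Unit using (⊤; tt)
open import Data.Sum using (_⊎_; inj₁; inj₂)
open import Data.Product using (Σ; ∃; _×_; _,_)
open import Relation.Binary.PropositionalEquality using (_≡_)
open import Relation.Binary.Core using (Rel)
open import Relation.Binary.Structures using (IsTotalOrder)
open import Relation.Nullary using (¬_)
open import Algebra.Structures using (IsCommutativeRing)

-- An abstract model of the real numbers: a complete ordered field
-- (all such models are isomorphic to ℝ).
record Reals : Set₁ where
  infixl 6 _+_ _-_
  infixl 7 _*_
  infix 4 _≤_ _<_
  field
    Carrier : Set
    _+_ _*_ : Carrier → Carrier → Carrier
    -_ : Carrier → Carrier
    0# 1# : Carrier
    _≤_ : Rel Carrier 0ℓ
    isCommutativeRing : IsCommutativeRing _≡_ _+_ _*_ -_ 0# 1#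
    isTotalOrder : IsTotalOrder _≡_ _≤_
    0≢1 : ¬ (0# ≡ 1#)
    inverse : ∀ x → ¬ (x ≡ 0#) → Σ Carrier (λ y → x * y ≡ 1#)
    +-mono-≤ : ∀ x y z → x ≤ y → x + z ≤ y + z
    *-nonneg : ∀ x y → 0# ≤ x → 0# ≤ y → 0# ≤ x * y
    sup : (S : Carrier → Set) → ∃ S → (∃ λ b → ∀ x → S x → x ≤ b) →
          ∃ λ s → (∀ x → S x → x ≤ s) × (∀ b → (∀ x → S x → x ≤ b) → s ≤ b)

  _-_ : Carrier → Carrier → Carrier
  x - y = x + (- y)

  _<_ : Carrier → Carrier → Set
  x < y = (x ≤ y) × ¬ (x ≡ y)

  total : ∀ x y → x ≤ y ⊎ y ≤ x
  total = IsTotalOrder.total isTotalOrder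

  abs : Carrier → Carrier
  abs x with total 0# x
  ... | inj₁ _ = x
  ... | inj₂ _ = - x

  2# : Carrier
  2# = 1# + 1#

module MetricTrees (R : Reals) where
  open Reals R

  -- A metric tree with n edges (n+1 vertices), built by repeatedly attaching a
  -- new leaf edge of positive length ℓ at an existing vertex p.
  -- Every finite tree with ≥ 1 vertex arises this way (remove leaves).
  data MTree : ℕ → Set where
    single : MTree 0
    grow : ∀ {n} → MTree n → (p : Fin (suc n)) → (ℓ : Carrier) → 0# < ℓ → MTree (suc n)

  -- Points of the metric tree: points of the old tree, or a point on the new
  -- edge at distance t ∈ (0, ℓ] from the attaching vertex p.
  Point : ∀ {n} → MTree n → Set
  Point single = ⊤
  Point (grow T p ℓ _) = Point T ⊎ Σ Carrier (λ t → (0# < t) × (t ≤ ℓ))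

  vtx : ∀ {n} (T : MTree n) → Fin (suc n) → Point T
  vtx single zero = tt
  vtx (grow T p ℓ ℓ>0) zero = inj₂ (ℓ , ℓ>0 , IsTotalOrder.refl isTotalOrder)
  vtx (grow T p ℓ _) (suc i) = inj₁ (vtx T i)

  dist : ∀ {n} (T : MTree n) → Point T → Point T → Carrier
  dist single _ _ = 0#
  dist (grow T p ℓ _) (inj₁ x) (inj₁ y) = dist T x y
  dist (grow T p ℓ _) (inj₁ x) (inj₂ (t , _)) = dist T x (vtx T p) + t
  dist (grow T p ℓ _) (inj₂ (s , _)) (inj₁ y) = s + dist T (vtx T p) y
  dist (grow T p ℓ _) (inj₂ (s , _)) (inj₂ (t , _)) = abs (s - t)

  size : ∀ {n} → MTree n → Carrier
  size single = 0#
  size (grow T p ℓ _) = size T + ℓ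

  InBall : ∀ {n} (T : MTree n) → Point T → Carrier → Point T → Set
  InBall T v r u = dist T v u ≤ r

  IsCover : ∀ {n} (T : MTree n) (m : ℕ) → (Fin m → Carrier) → Set
  IsCover T m r = Σ (Fin m → Point T) λ v →
    ∀ (u : Point T) → Σ (Fin m) λ i → InBall T (v i) (r i) u

  pair : Carrier → Carrier → Fin 2 → Carrier
  pair a b zero = a
  pair a b (suc _) = b

Thm6p4 : Reals → Set
Thm6p4 R = (r₁ r₂ : Carrier) → 0# ≤ r₁ → 2# * r₁ ≤ r₂ →
    ∀ {n} (T : MTree n) → size T ≤ 2# * (r₁ + r₂) →
    IsCover T 2 (pair r₁ r₂)
  where open Reals R
        open MetricTrees R

{-# OPTIONS --safe #-}
-- Let a, b be a diametral pair of vertices, D = d(a,b).  If D ≤ 2r₂, one ball of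
-- radius r₂ suffices.  Otherwise put the r₁-ball at one end of the path from a to b
-- and the r₂-ball at the other end: by diametrality a ball centred on the path at
-- distance r from an end contains every point within 2r of that end.  If this fails
-- both ways round, some u has d(a,u) > 2r₁, d(b,u) > 2r₂ and some w has
-- d(b,w) > 2r₁, d(a,w) > 2r₂.  If u and w branch off the path at different points,
-- the subtree spanned by a, b, u, w has length
--   ½ (d(a,u) + d(b,u) + d(a,w) + d(b,w)) > 2(r₁ + r₂) ≥ |T|.
-- If they branch off at the same point, then d(a,u) + d(b,w) = d(a,w) + d(b,u) > 4r₂,
-- and adding the lengths of the two tripods a, b, u and a, b, w gives
-- 8r₂ + 2D < 8(r₁ + r₂), which contradicts D ≥ 2r₂ ≥ 4r₁.
module Submission where

open import Algebra.Bundles using (CommutativeRing)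
open import Data.Empty using (⊥; ⊥-elim)
open import Data.Fin using (Fin; zero; suc)
open import Data.Nat using (ℕ; suc)
open import Data.Product using (Σ; ∃; ∃₂; _×_; _,_; proj₁; proj₂)
open import Data.Sum using (_⊎_; inj₁; inj₂; [_,_]′; swap; map; map₂)
open import Data.Unit using (tt)
open import Relation.Binary.Structures using (IsTotalOrder)
open import Relation.Binary.PropositionalEquality
  using (_≡_; refl; sym; trans; cong; cong₂; subst; subst₂)
open import Relation.Nullary using (¬_; Dec; yes; no)
import Algebra.Solver.CommutativeMonoid
import Algebra.Properties.Ring

open import Defs

-- Linear arithmetic in an ordered field.

module OrderedField (R : Reals) where
  open Reals R
  open IsTotalOrder isTotalOrder public
    using (antisym)
    renaming (refl to ≤-refl; reflexive to ≤-reflexive; trans to ≤-trans)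

  commutativeRing : CommutativeRing _ _
  commutativeRing = record { isCommutativeRing = isCommutativeRing }

  open CommutativeRing commutativeRing public
    using (+-comm; +-assoc; +-identityˡ; +-identityʳ; -‿inverseʳ; -‿inverseˡ;
           *-identityˡ; distribʳ; ring; +-commutativeMonoid)
  open Algebra.Properties.Ring ring public
    using (-1*x≈-x; -‿involutive; +-cancelʳ)
  open Algebra.Solver.CommutativeMonoid +-commutativeMonoid public
    using (solve; _⊜_; _⊕_; id)

  infixr 5 _⊹_
  _⊹_ : ∀ {a b c d} → a ≤ b → c ≤ d → a + c ≤ b + d
  _⊹_ {a} {b} {c} {d} a≤b c≤d =
    ≤-trans (+-mono-≤ a b c a≤b)
      (subst₂ _≤_ (+-comm c b) (+-comm d b) (+-mono-≤ c d b c≤d))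

  +-cancelʳ-≤ : ∀ {x y} z → x + z ≤ y + z → x ≤ y
  +-cancelʳ-≤ {x} {y} z h =
    subst₂ _≤_ (undo x) (undo y) (+-mono-≤ (x + z) (y + z) (- z) h)
    where
    undo : ∀ w → (w + z) + - z ≡ w
    undo w = trans (+-assoc w z (- z))
      (trans (cong (w +_) (-‿inverseʳ z)) (+-identityʳ w))

  -- Moving everything to the side where it is positive makes the equation an
  -- identity of commutative monoids, which the solver proves.
  linear : ∀ {a b x y} → a ≤ b → x + b ≡ y + a → x ≤ y
  linear {a} {b} {x} {y} a≤b eq =
    +-cancelʳ-≤ a (subst (x + a ≤_) eq (≤-refl ⊹ a≤b))

  linear-≡ : ∀ {a b x y} → a ≡ b → x + b ≡ y + a → x ≡ y
  linear-≡ {a} {x = x} {y} refl eq = +-cancelʳ a x y eq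

  halve-≤ : ∀ {x y} → x + x ≤ y + y → x ≤ y
  halve-≤ {x} {y} h with total x y
  ... | inj₁ x≤y = x≤y
  ... | inj₂ y≤x = linear (h ⊹ y≤x)
        (solve 2 (λ x y → x ⊕ ((y ⊕ y) ⊕ x) ⊜ y ⊕ ((x ⊕ x) ⊕ y)) refl x y)

  double : ∀ x → 2# * x ≡ x + x
  double x = trans (distribʳ x 1# 1#) (cong₂ _+_ (*-identityˡ x) (*-identityˡ x))

  -- Deciding the order by means of suprema.

  1≰0 : ¬ (1# ≤ 0#)
  1≰0 1≤0 = 0≢1 (antisym 0≤1 1≤0)
    where
    -- Were `1# ≤ 0#`, then `- 1#` would be nonnegative, hence also its square `1#`, and
    -- antisymmetry would identify `0#` with `1#`.
    0≤-1 : 0# ≤ - 1#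
    0≤-1 = subst₂ _≤_ (-‿inverseʳ 1#) (+-identityˡ (- 1#)) (+-mono-≤ 1# 0# (- 1#) 1≤0)
    0≤1 : 0# ≤ 1#
    0≤1 = subst (0# ≤_) (trans (-1*x≈-x (- 1#)) (-‿involutive 1#))
            (*-nonneg (- 1#) (- 1#) 0≤-1 0≤-1)

  -- The supremum of {0} ∪ {2 | P} lies on one side of 1.
  weak-excluded-middle : (P : Set) → ¬ P ⊎ ¬ ¬ P
  weak-excluded-middle P = decide (sup S (0# , inj₁ refl) (2# , bound))
    where
    S : Carrier → Set
    S z = z ≡ 0# ⊎ (z ≡ 2# × P)
    0≤1 : 0# ≤ 1#
    0≤1 = [ (λ h → h) , (λ h → ⊥-elim (1≰0 h)) ]′ (total 0# 1#)
    bound : ∀ z → S z → z ≤ 2#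
    bound z (inj₁ refl) = subst (_≤ 2#) (+-identityˡ 0#) (0≤1 ⊹ 0≤1)
    bound z (inj₂ (refl , _)) = ≤-refl
    decide : (∃ λ s → (∀ x → S x → x ≤ s) × (∀ b → (∀ x → S x → x ≤ b) → s ≤ b)) →
             ¬ P ⊎ ¬ ¬ P
    decide (s , upper , least) with total s 1#
    ... | inj₁ s≤1 = inj₁ λ p → 1≰0 (linear (≤-trans (upper 2# (inj₂ (refl , p))) s≤1)
            (solve 1 (λ o → o ⊕ o ⊜ id ⊕ (o ⊕ o)) refl 1#))
    ... | inj₂ 1≤s = inj₂ λ ¬p → 1≰0 (≤-trans 1≤s (least 0# λ where
            z (inj₁ refl) → ≤-refl
            z (inj₂ (_ , p)) → ⊥-elim (¬p p)))

  -- The set of z with ¬ ¬ (z ≤ 0) is closed under addition, so its supremum s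
  -- satisfies s ≤ s - z for every member z.
  ≤0-stable : ∀ x → ¬ ¬ (x ≤ 0#) → x ≤ 0#
  ≤0-stable x x∈S with sup (λ z → ¬ ¬ (z ≤ 0#)) (0# , λ k → k ≤-refl) (1# , bound)
    where
    bound : ∀ z → ¬ ¬ (z ≤ 0#) → z ≤ 1#
    bound z h with total z 1#
    ... | inj₁ z≤1 = z≤1
    ... | inj₂ 1≤z = ⊥-elim (h λ z≤0 → 1≰0 (≤-trans 1≤z z≤0))
  ... | s , upper , least = linear (least (s - x) s-x-bound)
    (trans (linear-≡ (-‿inverseʳ x)
      (solve 3 (λ x n s → (x ⊕ (s ⊕ n)) ⊕ id ⊜ s ⊕ (x ⊕ n)) refl x (- x) s))
      (sym (+-identityˡ s)))
    where
    s-x-bound : ∀ z → ¬ ¬ (z ≤ 0#) → z ≤ s - x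
    s-x-bound z z∈S = linear
      (upper (z + x) (λ k → z∈S λ z≤0 → x∈S λ x≤0 →
         k (subst (z + x ≤_) (+-identityˡ 0#) (z≤0 ⊹ x≤0))))
      (linear-≡ (sym (-‿inverseʳ x))
        (solve 4 (λ x n s z → (z ⊕ s) ⊕ (x ⊕ n) ⊜ ((s ⊕ n) ⊕ (z ⊕ x)) ⊕ id) refl x (- x) s z))

  ≤-stable : ∀ {x y} → ¬ ¬ (x ≤ y) → x ≤ y
  ≤-stable {x} {y} h = linear (≤0-stable (x - y) λ k → h λ x≤y →
      k (subst (x - y ≤_) (-‿inverseʳ y) (+-mono-≤ x y (- y) x≤y)))
    (linear-≡ (sym (-‿inverseʳ y))
      (solve 3 (λ x y n → (x ⊕ id) ⊕ (y ⊕ n) ⊜ (y ⊕ (x ⊕ n)) ⊕ id) refl x y (- y)))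

  -- Weak excluded middle yields `¬ (x ≤ y)` or its negation, and stability turns the latter into
  -- `x ≤ y`.
  _≤?_ : ∀ x y → Dec (x ≤ y)
  x ≤? y with weak-excluded-middle (x ≤ y)
  ... | inj₁ x≰y = no x≰y
  ... | inj₂ h = yes (≤-stable h)

  ≰⇒≥ : ∀ {x y} → ¬ (x ≤ y) → y ≤ x
  ≰⇒≥ {x} {y} h = [ (λ x≤y → ⊥-elim (h x≤y)) , (λ y≤x → y≤x) ]′ (total x y)

  -- Differences and absolute values.

  difference : ∀ x y → Σ Carrier λ z → z + y ≡ x
  difference x y = x - y , linear-≡ (-‿inverseʳ y)
    (solve 3 (λ x y n → ((x ⊕ n) ⊕ y) ⊕ id ⊜ x ⊕ (y ⊕ n)) refl x y (- y))

  difference-nonneg : ∀ {x y z} → z + y ≡ x → y ≤ x → 0# ≤ z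
  difference-nonneg {y = y} {z} refl h = linear h
    (solve 2 (λ y z → id ⊕ (z ⊕ y) ⊜ z ⊕ y) refl y z)

  -- The value of `abs` is pinned down by a sum, so that later uses stay free of negation and within
  -- reach of the commutative-monoid solver.
  abs-cases : ∀ s t → (t ≤ s × abs (s - t) + t ≡ s) ⊎ (s ≤ t × abs (s - t) + s ≡ t)
  abs-cases s t with total 0# (s - t)
  ... | inj₁ 0≤s-t = inj₁
        (linear 0≤s-t (trans (trans (+-comm t (s - t)) s-t+t≡s) (sym (+-identityʳ s))) , s-t+t≡s)
    where
    s-t+t≡s : s - t + t ≡ s
    s-t+t≡s = proj₂ (difference s t)
  ... | inj₂ s-t≤0 = inj₂
        (linear s-t≤0 (trans (+-identityʳ s) (trans (sym s-t+t≡s) (+-comm (s - t) t))) ,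
         trans (cong (- (s - t) +_) (sym s-t+t≡s))
           (trans (sym (+-assoc (- (s - t)) (s - t) t))
             (trans (cong (_+ t) (-‿inverseˡ (s - t))) (+-identityˡ t))))
    where
    s-t+t≡s : s - t + t ≡ s
    s-t+t≡s = proj₂ (difference s t)

  abs-≥ : ∀ {s t} → t ≤ s → abs (s - t) + t ≡ s
  abs-≥ {s} {t} t≤s with abs-cases s t
  ... | inj₁ (_ , e) = e
  ... | inj₂ (s≤t , e) =
    trans (cong (abs (s - t) +_) (antisym t≤s s≤t)) (trans e (antisym t≤s s≤t))

  abs-≤ : ∀ {s t} → s ≤ t → abs (s - t) + s ≡ t
  abs-≤ {s} {t} s≤t with abs-cases s t
  ... | inj₁ (t≤s , e) =
    trans (cong (abs (s - t) +_) (antisym s≤t t≤s)) (trans e (antisym s≤t t≤s))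
  ... | inj₂ (_ , e) = e

  abs-sym : ∀ s t → abs (s - t) ≡ abs (t - s)
  abs-sym s t with total s t
  ... | inj₁ s≤t = +-cancelʳ s _ _ (trans (abs-≤ s≤t) (sym (abs-≥ s≤t)))
  ... | inj₂ t≤s = +-cancelʳ t _ _ (trans (abs-≥ t≤s) (sym (abs-≤ t≤s)))

  abs-self : ∀ s → abs (s - s) ≡ 0#
  abs-self s = +-cancelʳ s _ _ (trans (abs-≥ ≤-refl) (sym (+-identityˡ s)))

  abs-bound : ∀ {s t ℓ} → 0# ≤ s → s ≤ ℓ → 0# ≤ t → t ≤ ℓ → abs (s - t) ≤ ℓ
  abs-bound {s} {t} {ℓ} 0≤s s≤ℓ 0≤t t≤ℓ with total s t
  ... | inj₁ s≤t = linear (≤-reflexive (abs-≤ s≤t) ⊹ 0≤s ⊹ t≤ℓ)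
        (solve 4 (λ f s t l → f ⊕ (t ⊕ (s ⊕ l)) ⊜ l ⊕ ((f ⊕ s) ⊕ (id ⊕ t)))
          refl (abs (s - t)) s t ℓ)
  ... | inj₂ t≤s = linear (≤-reflexive (abs-≥ t≤s) ⊹ 0≤t ⊹ s≤ℓ)
        (solve 4 (λ f s t l → f ⊕ (s ⊕ (t ⊕ l)) ⊜ l ⊕ ((f ⊕ t) ⊕ (id ⊕ s)))
          refl (abs (s - t)) s t ℓ)

-- Distances in a metric tree and the geometry of a path in it.

module Trees (R : Reals) where
  open Reals R
  open OrderedField R
  open MetricTrees R

  private
    variable
      n : ℕ

  dist-sym : (T : MTree n) (x y : Point T) → dist T x y ≡ dist T y x
  dist-sym single _ _ = refl
  dist-sym (grow T p ℓ _) (inj₁ x) (inj₁ y) = dist-sym T x y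
  dist-sym (grow T p ℓ _) (inj₁ x) (inj₂ (t , _)) =
    trans (+-comm _ t) (cong (t +_) (dist-sym T x (vtx T p)))
  dist-sym (grow T p ℓ _) (inj₂ (s , _)) (inj₁ y) =
    trans (+-comm s _) (cong (_+ s) (dist-sym T (vtx T p) y))
  dist-sym (grow T p ℓ _) (inj₂ (s , _)) (inj₂ (t , _)) = abs-sym s t

  dist-refl : (T : MTree n) (x : Point T) → dist T x x ≡ 0#
  dist-refl single _ = refl
  dist-refl (grow T p ℓ _) (inj₁ x) = dist-refl T x
  dist-refl (grow T p ℓ _) (inj₂ (s , _)) = abs-self s

  -- On the path from a to b, the point at distance c from a and c′ from b has
  -- distance max (dist a u - c) (dist b u - c′) to u; `point` needs only "≤".
  -- `tripod` bounds the length of the subtree spanned by a, b and u.  In `quartet`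
  -- the equality says that u and w project to the same point of the path;
  -- otherwise the subtree spanned by a, b, u and w has the length bounded there.
  record Spine (T : MTree n) (a b : Point T) : Set where
    field
      point : ∀ c c′ → 0# ≤ c → 0# ≤ c′ → c + c′ ≡ dist T a b →
        Σ (Point T) λ x → ∀ u →
          dist T x u + c ≤ dist T a u ⊎ dist T x u + c′ ≤ dist T b u
      tripod : ∀ u → dist T a u + dist T b u + dist T a b ≤ size T + size T
      quartet : ∀ u w →
        dist T a u + dist T b w ≡ dist T a w + dist T b u ⊎
        (dist T a u + dist T b u) + (dist T a w + dist T b w) ≤ size T + size T

  open Spine

  spine-sym : {T : MTree n} {a b : Point T} → Spine T a b → Spine T b a
  spine-sym {T = T} {a} {b} S = record
    { point = λ c c′ 0≤c 0≤c′ e →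
        let x , near = S .point c′ c 0≤c′ 0≤c (trans (+-comm c′ c) (trans e (dist-sym T b a)))
        in x , λ u → swap (near u)
    ; tripod = λ u → subst (_≤ size T + size T)
        (cong₂ _+_ (+-comm (dist T a u) (dist T b u)) (dist-sym T a b)) (S .tripod u)
    ; quartet = λ u w → map
        (λ e → trans (+-comm (dist T b u) (dist T a w))
                 (trans (sym e) (+-comm (dist T a u) (dist T b w))))
        (subst (_≤ size T + size T)
          (cong₂ _+_ (+-comm (dist T a u) (dist T b u)) (+-comm (dist T a w) (dist T b w))))
        (S .quartet u w)
    }

  spine-single : Spine single tt tt
  spine-single = record
    { point = λ c c′ _ 0≤c′ e → tt , λ _ → inj₁
        -- Here `c + c′ = 0` and `0 ≤ c′`, so `c ≤ 0`.
        (linear (0≤c′ ⊹ ≤-reflexive e)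
          (solve 2 (λ c c′ → (id ⊕ c) ⊕ (c′ ⊕ id) ⊜ id ⊕ (id ⊕ (c ⊕ c′))) refl c c′))
    ; tripod = λ _ → ≤-reflexive (+-identityʳ _)
    ; quartet = λ _ _ → inj₁ refl
    }

  -- Spines after attaching a leaf edge.

  module _ {T : MTree n} {p : Fin (suc n)} {ℓ : Carrier} {0<ℓ : 0# < ℓ} where

    private
      T⁺ : MTree (suc n)
      T⁺ = grow T p ℓ 0<ℓ
      base : Point T
      base = vtx T p
      tip : Point T⁺
      tip = vtx T⁺ zero
      0≤ℓ : 0# ≤ ℓ
      0≤ℓ = proj₁ 0<ℓ
      σ : Carrier
      σ = size T

    shift : ∀ {e c d} t → e + c ≤ d → (e + t) + c ≤ d + t
    shift {e} {c} {d} t h = linear h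
      (solve 4 (λ e c d t → ((e ⊕ t) ⊕ c) ⊕ d ⊜ (d ⊕ t) ⊕ (e ⊕ c)) refl e c d t)

    -- Seen from the old tree, a point of the new edge is `base` with all distances raised by the
    -- same `t ≤ ℓ`. Claims about one such point thus follow from those about `base`, and the growth
    -- of `size` by `ℓ` pays for `t`.
    spine-lift : ∀ {a b} → Spine T a b → Spine T⁺ (inj₁ a) (inj₁ b)
    spine-lift {a} {b} S = record { point = point⁺ ; tripod = tripod⁺ ; quartet = quartet⁺ }
      where
      A B : Point T → Carrier
      A = dist T a
      B = dist T b
      D : Carrier
      D = dist T a b

      point⁺ : ∀ c c′ → 0# ≤ c → 0# ≤ c′ → c + c′ ≡ D → Σ (Point T⁺) λ x → ∀ u →
        dist T⁺ x u + c ≤ dist T⁺ (inj₁ a) u ⊎ dist T⁺ x u + c′ ≤ dist T⁺ (inj₁ b) u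
      point⁺ c c′ 0≤c 0≤c′ e =
        let x , near = S .point c c′ 0≤c 0≤c′ e
        in inj₁ x , λ where
          (inj₁ u) → near u
          (inj₂ (t , _)) → map (shift t) (shift t) (near base)

      tripod⁺ : ∀ u → dist T⁺ (inj₁ a) u + dist T⁺ (inj₁ b) u + D ≤ (σ + ℓ) + (σ + ℓ)
      tripod⁺ (inj₁ u) = linear (S .tripod u ⊹ 0≤ℓ ⊹ 0≤ℓ)
        (solve 5 (λ a b d s l →
            ((a ⊕ b) ⊕ d) ⊕ ((s ⊕ s) ⊕ (l ⊕ l)) ⊜
            ((s ⊕ l) ⊕ (s ⊕ l)) ⊕ (((a ⊕ b) ⊕ d) ⊕ (id ⊕ id)))
          refl (A u) (B u) D σ ℓ)
      tripod⁺ (inj₂ (t , _ , t≤ℓ)) = linear (S .tripod base ⊹ t≤ℓ ⊹ t≤ℓ)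
        (solve 6 (λ a b d s l t →
            (((a ⊕ t) ⊕ (b ⊕ t)) ⊕ d) ⊕ ((s ⊕ s) ⊕ (l ⊕ l)) ⊜
            ((s ⊕ l) ⊕ (s ⊕ l)) ⊕ (((a ⊕ b) ⊕ d) ⊕ (t ⊕ t)))
          refl (A base) (B base) D σ ℓ t)

      quartet⁺ : ∀ u w →
        dist T⁺ (inj₁ a) u + dist T⁺ (inj₁ b) w ≡ dist T⁺ (inj₁ a) w + dist T⁺ (inj₁ b) u ⊎
        (dist T⁺ (inj₁ a) u + dist T⁺ (inj₁ b) u) +
        (dist T⁺ (inj₁ a) w + dist T⁺ (inj₁ b) w) ≤ (σ + ℓ) + (σ + ℓ)
      quartet⁺ (inj₁ u) (inj₁ w) = map₂
        (λ h → linear (h ⊹ 0≤ℓ ⊹ 0≤ℓ)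
          (solve 6 (λ a b a′ b′ s l →
              ((a ⊕ b) ⊕ (a′ ⊕ b′)) ⊕ ((s ⊕ s) ⊕ (l ⊕ l)) ⊜
              ((s ⊕ l) ⊕ (s ⊕ l)) ⊕ (((a ⊕ b) ⊕ (a′ ⊕ b′)) ⊕ (id ⊕ id)))
            refl (A u) (B u) (A w) (B w) σ ℓ))
        (S .quartet u w)
      quartet⁺ (inj₁ u) (inj₂ (t , _ , t≤ℓ)) = map
        (λ e → linear-≡ e
          (solve 5 (λ a b a′ b′ t →
              (a ⊕ (b′ ⊕ t)) ⊕ (a′ ⊕ b) ⊜ ((a′ ⊕ t) ⊕ b) ⊕ (a ⊕ b′))
            refl (A u) (B u) (A base) (B base) t))
        (λ h → linear (h ⊹ t≤ℓ ⊹ t≤ℓ)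
          (solve 7 (λ a b a′ b′ s l t →
              ((a ⊕ b) ⊕ ((a′ ⊕ t) ⊕ (b′ ⊕ t))) ⊕ ((s ⊕ s) ⊕ (l ⊕ l)) ⊜
              ((s ⊕ l) ⊕ (s ⊕ l)) ⊕ (((a ⊕ b) ⊕ (a′ ⊕ b′)) ⊕ (t ⊕ t)))
            refl (A u) (B u) (A base) (B base) σ ℓ t))
        (S .quartet u base)
      quartet⁺ (inj₂ (t , _ , t≤ℓ)) (inj₁ w) = map
        (λ e → linear-≡ e
          (solve 5 (λ a b a′ b′ t →
              ((a ⊕ t) ⊕ b′) ⊕ (a′ ⊕ b) ⊜ (a′ ⊕ (b ⊕ t)) ⊕ (a ⊕ b′))
            refl (A base) (B base) (A w) (B w) t))
        (λ h → linear (h ⊹ t≤ℓ ⊹ t≤ℓ)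
          (solve 7 (λ a b a′ b′ s l t →
              (((a ⊕ t) ⊕ (b ⊕ t)) ⊕ (a′ ⊕ b′)) ⊕ ((s ⊕ s) ⊕ (l ⊕ l)) ⊜
              ((s ⊕ l) ⊕ (s ⊕ l)) ⊕ (((a ⊕ b) ⊕ (a′ ⊕ b′)) ⊕ (t ⊕ t)))
            refl (A base) (B base) (A w) (B w) σ ℓ t))
        (S .quartet base w)
      -- Both points project to the path where `base` does.
      quartet⁺ (inj₂ (t , _)) (inj₂ (t′ , _)) = inj₁
        (solve 4 (λ a b t t′ → (a ⊕ t) ⊕ (b ⊕ t′) ⊜ (a ⊕ t′) ⊕ (b ⊕ t))
          refl (A base) (B base) t t′)

    -- The tripod with third point `base` degenerates to the path counted twice.
    twice-length : ∀ {a} → Spine T a base → dist T a base + dist T a base ≤ σ + σ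
    twice-length {a} S = linear (S .tripod base ⊹ ≤-reflexive (sym (dist-refl T base)))
      (solve 3 (λ d z s → (d ⊕ d) ⊕ ((s ⊕ s) ⊕ z) ⊜ (s ⊕ s) ⊕ (((d ⊕ z) ⊕ d) ⊕ id))
        refl (dist T a base) (dist T base base) σ)

    -- The new edge prolongs the path. Old points keep their projections; a point `u` of the new
    -- edge lies on the path, so its distances to the two ends add up to `D + ℓ`.
    spine-extend : ∀ {a} → Spine T a base → Spine T⁺ (inj₁ a) tip
    spine-extend {a} S = record { point = point⁺ ; tripod = tripod⁺ ; quartet = quartet⁺ }
      where
      A B : Point T → Carrier
      A = dist T a
      B = dist T base
      D : Carrier
      D = dist T a base

      point⁺ : ∀ c c′ → 0# ≤ c → 0# ≤ c′ → c + c′ ≡ D + ℓ → Σ (Point T⁺) λ x → ∀ u →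
        dist T⁺ x u + c ≤ dist T⁺ (inj₁ a) u ⊎ dist T⁺ x u + c′ ≤ dist T⁺ tip u
      -- The point sought lies on the old path or at `m = c - D` beyond `base`. Deciding `c ≤ D`,
      -- instead of using `total`, makes `m` nonzero, as a `Point` of the new edge requires.
      point⁺ c c′ 0≤c 0≤c′ e with c ≤? D
      ... | yes c≤D = inj₁ x , near⁺
        where
        k : Carrier
        k = proj₁ (difference D c)
        k+c≡D : k + c ≡ D
        k+c≡D = proj₂ (difference D c)
        0≤k : 0# ≤ k
        0≤k = difference-nonneg k+c≡D c≤D
        old : Σ (Point T) λ x → ∀ u → dist T x u + c ≤ A u ⊎ dist T x u + k ≤ B u
        old = S .point c k 0≤c 0≤k (trans (+-comm c k) k+c≡D)
        x : Point T
        x = proj₁ old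
        near⁺ : ∀ u → dist T⁺ (inj₁ x) u + c ≤ dist T⁺ (inj₁ a) u ⊎
                      dist T⁺ (inj₁ x) u + c′ ≤ dist T⁺ tip u
        near⁺ (inj₁ u) = map₂
          (λ h → linear (h ⊹ ≤-reflexive e ⊹ ≤-reflexive (sym k+c≡D))
            (solve 7 (λ e b d l k c c′ →
                (e ⊕ c′) ⊕ (b ⊕ ((d ⊕ l) ⊕ (k ⊕ c))) ⊜
                (l ⊕ b) ⊕ ((e ⊕ k) ⊕ ((c ⊕ c′) ⊕ d)))
              refl (dist T x u) (B u) D ℓ k c c′))
          (proj₂ old u)
        near⁺ (inj₂ (t , _)) with proj₂ old base
        ... | inj₁ h = inj₁ (shift t h)
        -- Now `dist T x base ≤ - k`, and `c = D - k` with `0 ≤ k`, so `dist T x base + c ≤ D` holds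
        -- here as well.
        ... | inj₂ h = inj₁
          (linear (h ⊹ ≤-reflexive (dist-refl T base) ⊹ 0≤k ⊹ 0≤k ⊹ ≤-reflexive k+c≡D)
            (solve 6 (λ e z d k c t →
                ((e ⊕ t) ⊕ c) ⊕ (z ⊕ (id ⊕ (k ⊕ (k ⊕ d)))) ⊜
                (d ⊕ t) ⊕ ((e ⊕ k) ⊕ (z ⊕ (id ⊕ (id ⊕ (k ⊕ c))))))
              refl (dist T x base) (B base) D k c t))
      ... | no c≰D = inj₂ (m , (0≤m , 0≢m) , m≤ℓ) , near⁺
        where
        m : Carrier
        m = proj₁ (difference c D)
        m+D≡c : m + D ≡ c
        m+D≡c = proj₂ (difference c D)
        0≤m : 0# ≤ m
        0≤m = difference-nonneg m+D≡c (≰⇒≥ c≰D)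
        0≢m : ¬ (0# ≡ m)
        0≢m 0≡m = c≰D (≤-reflexive
          (trans (sym m+D≡c) (trans (cong (_+ D) (sym 0≡m)) (+-identityˡ D))))
        m≤ℓ : m ≤ ℓ
        m≤ℓ = linear (≤-reflexive m+D≡c ⊹ ≤-reflexive e ⊹ 0≤c′)
          (solve 5 (λ m d c c′ l →
              m ⊕ (c ⊕ ((d ⊕ l) ⊕ c′)) ⊜ l ⊕ ((m ⊕ d) ⊕ ((c ⊕ c′) ⊕ id)))
            refl m D c c′ ℓ)
        near⁺ : ∀ u → dist T⁺ (inj₂ (m , (0≤m , 0≢m) , m≤ℓ)) u + c ≤ dist T⁺ (inj₁ a) u ⊎
                      dist T⁺ (inj₂ (m , (0≤m , 0≢m) , m≤ℓ)) u + c′ ≤ dist T⁺ tip u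
        near⁺ (inj₁ u) = inj₂ (linear (≤-reflexive m+D≡c ⊹ ≤-reflexive e)
          (solve 6 (λ m b d c c′ l →
              ((m ⊕ b) ⊕ c′) ⊕ (c ⊕ (d ⊕ l)) ⊜ (l ⊕ b) ⊕ ((m ⊕ d) ⊕ (c ⊕ c′)))
            refl m (B u) D c c′ ℓ))
        near⁺ (inj₂ (t , _ , t≤ℓ)) with total m t
        ... | inj₁ m≤t = inj₁
          (linear (≤-reflexive (abs-≤ m≤t) ⊹ ≤-reflexive (sym m+D≡c))
            (solve 5 (λ e m d c t → (e ⊕ c) ⊕ (t ⊕ (m ⊕ d)) ⊜ (d ⊕ t) ⊕ ((e ⊕ m) ⊕ c))
              refl (abs (m - t)) m D c t))
        ... | inj₂ t≤m = inj₂
          (linear (≤-reflexive (abs-≥ t≤m) ⊹ ≤-reflexive (sym (abs-≥ t≤ℓ)) ⊹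
                   ≤-reflexive m+D≡c ⊹ ≤-reflexive e)
            (solve 8 (λ e f m d c c′ l t →
                (e ⊕ c′) ⊕ (m ⊕ ((f ⊕ t) ⊕ (c ⊕ (d ⊕ l)))) ⊜
                f ⊕ ((e ⊕ t) ⊕ (l ⊕ ((m ⊕ d) ⊕ (c ⊕ c′)))))
              refl (abs (m - t)) (abs (ℓ - t)) m D c c′ ℓ t))

      tripod⁺ : ∀ u → dist T⁺ (inj₁ a) u + dist T⁺ tip u + (D + ℓ) ≤ (σ + ℓ) + (σ + ℓ)
      tripod⁺ (inj₁ u) = linear (S .tripod u)
        (solve 5 (λ a b d s l →
            ((a ⊕ (l ⊕ b)) ⊕ (d ⊕ l)) ⊕ (s ⊕ s) ⊜ ((s ⊕ l) ⊕ (s ⊕ l)) ⊕ ((a ⊕ b) ⊕ d))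
          refl (A u) (B u) D σ ℓ)
      tripod⁺ (inj₂ (t , _ , t≤ℓ)) = linear (twice-length S ⊹ ≤-reflexive (abs-≥ t≤ℓ))
        (solve 5 (λ d f t s l →
            (((d ⊕ t) ⊕ f) ⊕ (d ⊕ l)) ⊕ ((s ⊕ s) ⊕ l) ⊜
            ((s ⊕ l) ⊕ (s ⊕ l)) ⊕ ((d ⊕ d) ⊕ (f ⊕ t)))
          refl D (abs (ℓ - t)) t σ ℓ)

      quartet⁺ : ∀ u w →
        dist T⁺ (inj₁ a) u + dist T⁺ tip w ≡ dist T⁺ (inj₁ a) w + dist T⁺ tip u ⊎
        (dist T⁺ (inj₁ a) u + dist T⁺ tip u) +
        (dist T⁺ (inj₁ a) w + dist T⁺ tip w) ≤ (σ + ℓ) + (σ + ℓ)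
      quartet⁺ (inj₁ u) (inj₁ w) = map
        (λ e → linear-≡ e
          (solve 5 (λ a b a′ b′ l →
              (a ⊕ (l ⊕ b′)) ⊕ (a′ ⊕ b) ⊜ (a′ ⊕ (l ⊕ b)) ⊕ (a ⊕ b′))
            refl (A u) (B u) (A w) (B w) ℓ))
        (λ h → linear h
          (solve 6 (λ a b a′ b′ s l →
              ((a ⊕ (l ⊕ b)) ⊕ (a′ ⊕ (l ⊕ b′))) ⊕ (s ⊕ s) ⊜
              ((s ⊕ l) ⊕ (s ⊕ l)) ⊕ ((a ⊕ b) ⊕ (a′ ⊕ b′)))
            refl (A u) (B u) (A w) (B w) σ ℓ))
        (S .quartet u w)
      -- The span is the tripod on `a`, `base`, `u` together with the whole new edge, so `tripod`
      -- for `u` gives the bound.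
      quartet⁺ (inj₁ u) (inj₂ (t , _ , t≤ℓ)) = inj₂
        (linear (S .tripod u ⊹ ≤-reflexive (abs-≥ t≤ℓ))
          (solve 7 (λ a b d f t s l →
              ((a ⊕ (l ⊕ b)) ⊕ ((d ⊕ t) ⊕ f)) ⊕ ((s ⊕ s) ⊕ l) ⊜
              ((s ⊕ l) ⊕ (s ⊕ l)) ⊕ (((a ⊕ b) ⊕ d) ⊕ (f ⊕ t)))
            refl (A u) (B u) D (abs (ℓ - t)) t σ ℓ))
      quartet⁺ (inj₂ (t , _ , t≤ℓ)) (inj₁ w) = inj₂
        (linear (S .tripod w ⊹ ≤-reflexive (abs-≥ t≤ℓ))
          (solve 7 (λ a b d f t s l →
              (((d ⊕ t) ⊕ f) ⊕ (a ⊕ (l ⊕ b))) ⊕ ((s ⊕ s) ⊕ l) ⊜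
              ((s ⊕ l) ⊕ (s ⊕ l)) ⊕ (((a ⊕ b) ⊕ d) ⊕ (f ⊕ t)))
            refl (A w) (B w) D (abs (ℓ - t)) t σ ℓ))
      quartet⁺ (inj₂ (t , _ , t≤ℓ)) (inj₂ (t′ , _ , t′≤ℓ)) = inj₂
        (linear (twice-length S ⊹ ≤-reflexive (abs-≥ t≤ℓ) ⊹ ≤-reflexive (abs-≥ t′≤ℓ))
          (solve 7 (λ d f t f′ t′ s l →
              (((d ⊕ t) ⊕ f) ⊕ ((d ⊕ t′) ⊕ f′)) ⊕ ((s ⊕ s) ⊕ (l ⊕ l)) ⊜
              ((s ⊕ l) ⊕ (s ⊕ l)) ⊕ ((d ⊕ d) ⊕ ((f ⊕ t) ⊕ (f′ ⊕ t′))))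
            refl D (abs (ℓ - t)) t (abs (ℓ - t′)) t′ σ ℓ))

    -- The path is a single point. The old spine enters through `tripod`, which bounds twice any
    -- distance from `base` by `σ + σ`.
    spine-tip : Spine T base base → Spine T⁺ tip tip
    spine-tip S = record
      { point = λ c c′ _ 0≤c′ e → tip , λ u → inj₁
          (linear (0≤c′ ⊹ ≤-reflexive e ⊹ ≤-reflexive (abs-self ℓ))
            (solve 4 (λ d c c′ z →
                (d ⊕ c) ⊕ (c′ ⊕ (z ⊕ id)) ⊜ d ⊕ (id ⊕ ((c ⊕ c′) ⊕ z)))
              refl (dist T⁺ tip u) c c′ (abs (ℓ - ℓ))))
      ; tripod = tripod⁺
      ; quartet = λ u w → inj₁ (+-comm (dist T⁺ tip u) (dist T⁺ tip w))
      }
      where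
      z : Carrier
      z = dist T base base
      0≤z : 0# ≤ z
      0≤z = ≤-reflexive (sym (dist-refl T base))

      tripod⁺ : ∀ u →
        dist T⁺ tip u + dist T⁺ tip u + abs (ℓ - ℓ) ≤ (σ + ℓ) + (σ + ℓ)
      tripod⁺ (inj₁ u) = linear (S .tripod u ⊹ ≤-reflexive (abs-self ℓ) ⊹ 0≤z)
        (solve 5 (λ b z z′ s l →
            (((l ⊕ b) ⊕ (l ⊕ b)) ⊕ z′) ⊕ ((s ⊕ s) ⊕ (id ⊕ z)) ⊜
            ((s ⊕ l) ⊕ (s ⊕ l)) ⊕ (((b ⊕ b) ⊕ z) ⊕ (z′ ⊕ id)))
          refl (dist T base u) z (abs (ℓ - ℓ)) σ ℓ)
      tripod⁺ (inj₂ (t , (0≤t , _) , t≤ℓ)) =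
        linear (f≤ℓ ⊹ f≤ℓ ⊹ twice-length S ⊹ ≤-reflexive (abs-self ℓ) ⊹ 0≤z ⊹ 0≤z)
          (solve 5 (λ f z z′ s l →
              ((f ⊕ f) ⊕ z′) ⊕ (l ⊕ (l ⊕ ((s ⊕ s) ⊕ (id ⊕ (z ⊕ z))))) ⊜
              ((s ⊕ l) ⊕ (s ⊕ l)) ⊕ (f ⊕ (f ⊕ ((z ⊕ z) ⊕ (z′ ⊕ (id ⊕ id))))))
            refl (abs (ℓ - t)) z (abs (ℓ - ℓ)) σ ℓ)
        where
        f≤ℓ : abs (ℓ - t) ≤ ℓ
        f≤ℓ = abs-bound 0≤ℓ ≤-refl 0≤t t≤ℓ

  -- Vertex `zero` is the leaf attached last; a spine ending there is built from one ending at its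
  -- attaching vertex `p`.
  spine : (T : MTree n) (i j : Fin (suc n)) → Spine T (vtx T i) (vtx T j)
  spine single zero zero = spine-single
  spine (grow T p ℓ _) zero zero = spine-tip (spine T p p)
  spine (grow T p ℓ _) zero (suc j) = spine-sym (spine-extend (spine T j p))
  spine (grow T p ℓ _) (suc i) zero = spine-extend (spine T i p)
  spine (grow T p ℓ _) (suc i) (suc j) = spine-lift (spine T i j)

  -- Farthest vertices and diametral pairs.

  -- From an old vertex, the tip dominates the new edge, so only the tip and the old farthest vertex
  -- compete. From the tip, paths into the old tree pass through `p`, so the vertex farthest from
  -- `p` serves.
  farthest : (T : MTree n) (i : Fin (suc n)) →
    ∃ λ j → ∀ u → dist T (vtx T i) u ≤ dist T (vtx T i) (vtx T j)
  farthest single zero = zero , λ _ → ≤-refl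
  farthest (grow T p ℓ (0≤ℓ , _)) zero =
    let j , far = farthest T p in suc j , λ where
      (inj₁ u) → ≤-refl ⊹ far u
      (inj₂ (t , (0≤t , _) , t≤ℓ)) → linear
        (abs-bound 0≤ℓ ≤-refl 0≤t t≤ℓ ⊹ far (vtx T p) ⊹ ≤-reflexive (sym (dist-refl T (vtx T p))))
        (solve 4 (λ f l d z → f ⊕ (l ⊕ (d ⊕ z)) ⊜ (l ⊕ d) ⊕ (f ⊕ (z ⊕ id)))
          refl (abs (ℓ - t)) ℓ (dist T (vtx T p) (vtx T j)) (dist T (vtx T p) (vtx T p)))
  farthest (grow T p ℓ 0<ℓ) (suc i) with farthest T i
  ... | j , far with total (dist T (vtx T i) (vtx T p) + ℓ) (dist T (vtx T i) (vtx T j))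
  ...   | inj₁ tip≤j = suc j , λ where
            (inj₁ u) → far u
            (inj₂ (t , _ , t≤ℓ)) → ≤-trans (≤-refl ⊹ t≤ℓ) tip≤j
  ...   | inj₂ j≤tip = zero , λ where
            (inj₁ u) → ≤-trans (far u) j≤tip
            (inj₂ (t , _ , t≤ℓ)) → ≤-refl ⊹ t≤ℓ

  -- With `E` the largest distance from `p` in the old tree, every distance involving the new edge
  -- is at most `ℓ + E`, attained by the tip and vertex `k`. This value competes with the old
  -- diameter `D`.
  diameter : (T : MTree n) →
    ∃₂ λ i j → ∀ x y → dist T x y ≤ dist T (vtx T i) (vtx T j)
  diameter single = zero , zero , λ _ _ → ≤-refl
  diameter (grow T p ℓ 0<ℓ) with diameter T | farthest T p
  ... | i , j , diam | k , far = choose (total D (ℓ + E))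
    where
    D E : Carrier
    D = dist T (vtx T i) (vtx T j)
    E = dist T (vtx T p) (vtx T k)
    0≤E : 0# ≤ E
    0≤E = ≤-trans (≤-reflexive (sym (dist-refl T (vtx T p)))) (far (vtx T p))
    bound : ∀ {M} → D ≤ M → ℓ + E ≤ M → ∀ x y → dist (grow T p ℓ 0<ℓ) x y ≤ M
    bound D≤M _ (inj₁ x) (inj₁ y) = ≤-trans (diam x y) D≤M
    bound _ E≤M (inj₁ x) (inj₂ (t , _ , t≤ℓ)) = ≤-trans
      (≤-trans (≤-reflexive (trans (+-comm _ t) (cong (t +_) (dist-sym T x (vtx T p)))))
        (t≤ℓ ⊹ far x))
      E≤M
    bound _ E≤M (inj₂ (s , _ , s≤ℓ)) (inj₁ y) = ≤-trans (s≤ℓ ⊹ far y) E≤M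
    bound _ E≤M (inj₂ (s , (0≤s , _) , s≤ℓ)) (inj₂ (t , (0≤t , _) , t≤ℓ)) =
      ≤-trans (≤-trans (≤-reflexive (sym (+-identityʳ _)))
        (abs-bound 0≤s s≤ℓ 0≤t t≤ℓ ⊹ 0≤E)) E≤M
    choose : D ≤ ℓ + E ⊎ ℓ + E ≤ D → ∃₂ λ i′ j′ → ∀ x y →
      dist (grow T p ℓ 0<ℓ) x y ≤
      dist (grow T p ℓ 0<ℓ) (vtx (grow T p ℓ 0<ℓ) i′) (vtx (grow T p ℓ 0<ℓ) j′)
    choose (inj₁ D≤E) = zero , suc k , bound D≤E ≤-refl
    choose (inj₂ E≤D) = suc i , suc j , bound ≤-refl E≤D

  -- Two balls at the ends of a diametral path.

  -- The centre is the path point at distance `r` from `a` and `k = D - r` from `b`. By `point`, its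
  -- distance to `u` is at most `dist T a u - r ≤ r` or at most `dist T b u - k ≤ D - k = r`.
  ball-at-end : {T : MTree n} {a b : Point T} → Spine T a b →
    (∀ u → dist T b u ≤ dist T a b) → ∀ {r} → 0# ≤ r → r ≤ dist T a b →
    Σ (Point T) λ x → ∀ u → dist T a u ≤ r + r → dist T x u ≤ r
  ball-at-end {T = T} {a} {b} S diam {r} 0≤r r≤D = x , covers
    where
    D k : Carrier
    D = dist T a b
    k = proj₁ (difference D r)
    k+r≡D : k + r ≡ D
    k+r≡D = proj₂ (difference D r)
    found : Σ (Point T) λ x → ∀ u →
      dist T x u + r ≤ dist T a u ⊎ dist T x u + k ≤ dist T b u
    found = S .point r k 0≤r (difference-nonneg k+r≡D r≤D) (trans (+-comm r k) k+r≡D)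
    x : Point T
    x = proj₁ found
    covers : ∀ u → dist T a u ≤ r + r → dist T x u ≤ r
    covers u near with proj₂ found u
    ... | inj₁ h = +-cancelʳ-≤ r (≤-trans h near)
    ... | inj₂ h = linear (h ⊹ diam u ⊹ ≤-reflexive (sym k+r≡D))
          (solve 5 (λ e k b d r →
              e ⊕ (b ⊕ (d ⊕ (k ⊕ r))) ⊜ r ⊕ ((e ⊕ k) ⊕ (b ⊕ d)))
            refl (dist T x u) k (dist T b u) D r)

  module _ {T : MTree n} {r₁ r₂ : Carrier} where

    cover-from-ends : ∀ {a b} → Spine T a b → (∀ x y → dist T x y ≤ dist T a b) →
      0# ≤ r₁ → r₁ ≤ dist T a b → 0# ≤ r₂ → r₂ ≤ dist T a b →
      (∀ u → dist T a u ≤ r₁ + r₁ ⊎ dist T b u ≤ r₂ + r₂) → IsCover T 2 (pair r₁ r₂)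
    cover-from-ends {a} {b} S diam 0≤r₁ r₁≤D 0≤r₂ r₂≤D split =
      (λ { zero → proj₁ ball₁ ; (suc _) → proj₁ ball₂ }) ,
      λ u → [ (λ h → zero , proj₂ ball₁ u h) , (λ h → suc zero , proj₂ ball₂ u h) ]′ (split u)
      where
      reverse : ∀ {x} → x ≤ dist T a b → x ≤ dist T b a
      reverse {x} = subst (x ≤_) (dist-sym T a b)
      ball₁ : Σ (Point T) λ x → ∀ u → dist T a u ≤ r₁ + r₁ → dist T x u ≤ r₁
      ball₁ = ball-at-end S (diam b) 0≤r₁ r₁≤D
      ball₂ : Σ (Point T) λ x → ∀ u → dist T b u ≤ r₂ + r₂ → dist T x u ≤ r₂
      ball₂ = ball-at-end (spine-sym S) (λ u → reverse (diam a u)) 0≤r₂ (reverse r₂≤D)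

    Missed : Point T → Point T → Point T → Set
    Missed a b u = ¬ (dist T a u ≤ r₁ + r₁) × ¬ (dist T b u ≤ r₂ + r₂)

    not-missed : ∀ {a b} → ¬ ∃ (Missed a b) →
      ∀ u → dist T a u ≤ r₁ + r₁ ⊎ dist T b u ≤ r₂ + r₂
    not-missed {a} {b} none u with dist T a u ≤? (r₁ + r₁) | dist T b u ≤? (r₂ + r₂)
    ... | yes h | _ = inj₁ h
    ... | no _ | yes h = inj₂ h
    ... | no h | no h′ = ⊥-elim (none (u , h , h′))

    not-both-missed : ∀ {a b u w} → Spine T a b → r₂ + r₂ ≤ dist T a b → r₁ + r₁ ≤ r₂ →
      size T ≤ (r₁ + r₂) + (r₁ + r₂) → Missed a b u → Missed b a w → ⊥
    not-both-missed {a} {b} {u} {w} S 2r₂≤D 2r₁≤r₂ σ≤ (¬Au , ¬Bu) (¬Bw , ¬Aw)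
      with S .quartet u w
    -- The other failures are used as weak inequalities; strictness enters once, when the derived
    -- `dist T a w ≤ r₂ + r₂` meets `¬Aw`.
    ... | inj₂ h = ¬Aw (linear
          (≰⇒≥ ¬Au ⊹ ≰⇒≥ ¬Bu ⊹ ≰⇒≥ ¬Bw ⊹ h ⊹ σ≤ ⊹ σ≤)
          (solve 7 (λ a b a′ b′ s r q →
              a′ ⊕ (a ⊕ (b ⊕ (b′ ⊕ ((s ⊕ s) ⊕ (((r ⊕ q) ⊕ (r ⊕ q)) ⊕ ((r ⊕ q) ⊕ (r ⊕ q))))))) ⊜
              (q ⊕ q) ⊕ ((r ⊕ r) ⊕ ((q ⊕ q) ⊕ ((r ⊕ r) ⊕ (((a ⊕ b) ⊕ (a′ ⊕ b′)) ⊕ (s ⊕ s))))))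
            refl (dist T a u) (dist T b u) (dist T a w) (dist T b w) (size T) r₁ r₂))
    -- Inserting `e` into the sum of both tripods gives `2 (dist T a w + dist T b u) + 2 D ≤ 8 (r₁ +
    -- r₂)`. As `dist T b u` and `D` are at least `2 r₂`, this leaves `2 dist T a w ≤ 8 r₁ ≤ 4 r₂`.
    ... | inj₁ e = ¬Aw (halve-≤ (linear
          (≤-reflexive (sym e) ⊹ S .tripod u ⊹ S .tripod w ⊹
           (≰⇒≥ ¬Bu ⊹ ≰⇒≥ ¬Bu) ⊹ (2r₂≤D ⊹ 2r₂≤D) ⊹
           ((σ≤ ⊹ σ≤) ⊹ (σ≤ ⊹ σ≤)) ⊹ (2r₁≤r₂ ⊹ 2r₁≤r₂) ⊹ (2r₁≤r₂ ⊹ 2r₁≤r₂))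
          (solve 8 (λ a b a′ b′ d s r q →
              let τ = (r ⊕ q) ⊕ (r ⊕ q) in
              (a′ ⊕ a′) ⊕ ((a ⊕ b′) ⊕ ((s ⊕ s) ⊕ ((s ⊕ s) ⊕ ((b ⊕ b) ⊕ ((d ⊕ d) ⊕
                (((τ ⊕ τ) ⊕ (τ ⊕ τ)) ⊕ ((q ⊕ q) ⊕ (q ⊕ q)))))))) ⊜
              ((q ⊕ q) ⊕ (q ⊕ q)) ⊕ ((a′ ⊕ b) ⊕ (((a ⊕ b) ⊕ d) ⊕ (((a′ ⊕ b′) ⊕ d) ⊕
                (((q ⊕ q) ⊕ (q ⊕ q)) ⊕ (((q ⊕ q) ⊕ (q ⊕ q)) ⊕ (((s ⊕ s) ⊕ (s ⊕ s)) ⊕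
                (((r ⊕ r) ⊕ (r ⊕ r)) ⊕ ((r ⊕ r) ⊕ (r ⊕ r))))))))))
            refl (dist T a u) (dist T b u) (dist T a w) (dist T b w)
                 (dist T a b) (size T) r₁ r₂)))

  -- Case analysis on the diameter.

  two-balls-cover : Thm6p4 R
  two-balls-cover r₁ r₂ 0≤r₁ 2#r₁≤r₂ T σ≤ with diameter T
  ... | i , j , diam = main (total D r₂) (total D (r₂ + r₂))
    where
    a b : Point T
    a = vtx T i
    b = vtx T j
    D : Carrier
    D = dist T a b
    S : Spine T a b
    S = spine T i j
    2r₁≤r₂ : r₁ + r₁ ≤ r₂
    2r₁≤r₂ = subst (_≤ r₂) (double r₁) 2#r₁≤r₂
    r₁≤r₂ : r₁ ≤ r₂
    r₁≤r₂ = linear (2r₁≤r₂ ⊹ 0≤r₁)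
      (solve 2 (λ r q → r ⊕ (q ⊕ r) ⊜ q ⊕ ((r ⊕ r) ⊕ id)) refl r₁ r₂)
    0≤r₂ : 0# ≤ r₂
    0≤r₂ = ≤-trans 0≤r₁ r₁≤r₂
    reverse : ∀ {x} → x ≤ D → x ≤ dist T b a
    reverse {x} = subst (x ≤_) (dist-sym T a b)

    main : D ≤ r₂ ⊎ r₂ ≤ D → D ≤ r₂ + r₂ ⊎ r₂ + r₂ ≤ D → IsCover T 2 (pair r₁ r₂)
    -- The path may be too short to hold a centre at distance `r₂` from its end, but any `r₂`-ball
    -- is then the whole tree; the centre of the other ball is arbitrary.
    main (inj₁ D≤r₂) _ = (λ _ → a) , λ u → suc zero , ≤-trans (diam a u) D≤r₂
    main (inj₂ r₂≤D) (inj₁ D≤2r₂) =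
      cover-from-ends S diam 0≤r₁ (≤-trans r₁≤r₂ r₂≤D) 0≤r₂ r₂≤D
        (λ u → inj₂ (≤-trans (diam b u) D≤2r₂))
    main (inj₂ r₂≤D) (inj₂ 2r₂≤D)
      with weak-excluded-middle (∃ (Missed {T = T} {r₁} {r₂} a b))
         | weak-excluded-middle (∃ (Missed {T = T} {r₁} {r₂} b a))
    ... | inj₁ none | _ =
      cover-from-ends S diam 0≤r₁ (≤-trans r₁≤r₂ r₂≤D) 0≤r₂ r₂≤D (not-missed none)
    ... | inj₂ _ | inj₁ none =
      cover-from-ends (spine-sym S) (λ x y → reverse (diam x y))
        0≤r₁ (reverse (≤-trans r₁≤r₂ r₂≤D)) 0≤r₂ (reverse r₂≤D) (not-missed none)
    -- The missed points exist only up to double negation, which suffices because the goal is a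
    -- contradiction.
    ... | inj₂ some | inj₂ some′ = ⊥-elim (some λ (u , missed) → some′ λ (w , missed′) →
      not-both-missed S 2r₂≤D 2r₁≤r₂ (subst (size T ≤_) (double (r₁ + r₂)) σ≤) missed missed′)

theorem6p4 : (R : Reals) → Thm6p4 R
theorem6p4 R = Trees.two-balls-cover R
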